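{- For all integers $k \ge 1$ and $n \ge 1$, $$C(k,n) \le \left( \sum_{w \in \Sigma_k^n} \left\lceil \frac{n}{\operatorname{per}(w)} \right\rceil \right) + n - 1 .$$
   Context: $\Sigma_k = \{0,1,\ldots,k-1\}$ is an alphabet of $k \ge 1$ letters and $\Sigma_k^n$ is the set of words of length $n$ over it. A word $w$ has period $q \ge 1$ if $w[i] = w[i+q]$ for all $i$ for which both sides are defined; $\operatorname{per}(w)$ denotes the smallest period of a nonempty word $w$. Two distinct occurrences of a length-$n$ word $x$ in a word $w$, say $x = w[i..i+n-1] = w[j..j+n-1]$ with $i<j$, overlap each other if $0<j-i<n$, and are disjoint if they do not overlap (i.e., $j - i \ge n$). For $k,n\ge 1$, $C(k,n)$ is the length of the longest word over $\Sigma_k$ that does not contain two disjoint occurrences of the same length-$n$ word (this maximum exists by the pigeonhole principle). -}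

module Defs where

open import Data.Fin as Fin using (Fin; toℕ; finToFun; funToFin)
open import Data.Fin.Properties as Fin using (all?; toℕ<n; pigeonhole; finToFun-funToFin)
open import Data.List as List using (List; allFin; cartesianProductWith; length; take; drop)
open import Data.List.Membership.Propositional using (_∈_; find; lose)
open import Data.List.Membership.Propositional.Properties
  using (∈-allFin; ∈-cartesianProductWith⁺)
open import Data.List.Properties as List using (length-take; length-drop)
open import Data.List.Relation.Unary.All using ([]; _∷_)
open import Data.List.Relation.Unary.AllPairs using ([]; _∷_)
open import Data.List.Relation.Unary.Any as Any using (here)
open import Data.List.Relation.Unary.Unique.Propositional using (Unique)
open import Data.List.Relation.Unary.Unique.Propositional.Properties
  using (allFin⁺; cartesianProductWith⁺)
open import Data.Nat
open import Data.Nat.DivMod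
open import Data.Nat.Properties
open import Data.Product using (∃; ∃-syntax; _×_; _,_; proj₁; proj₂)
open import Data.Vec using (Vec; []; _∷_; lookup; toList; fromList; tabulate)
open import Data.Vec.Properties
  using (tabulate∘lookup; tabulate-cong; toList∘fromList; length-toList; ∷-injective)
open import Function using (_∘_; _⇔_; mk⇔)
open import Level using (0ℓ)
open import Relation.Binary.PropositionalEquality
open import Relation.Nullary
open import Relation.Nullary.Decidable using (map′; _×-dec_; _→-dec_)
open import Relation.Unary using (Pred; Decidable)

IsLeast : Pred ℕ 0ℓ → ℕ → Set
IsLeast P m = P m × (∀ r → P r → m ≤ r)

IsGreatest : Pred ℕ 0ℓ → ℕ → Set
IsGreatest P m = P m × (∀ r → P r → r ≤ m)

least : {P : Pred ℕ 0ℓ} → Decidable P → ∀ b → P b → ∃ (IsLeast P)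
least P? zero    p = 0 , p , λ _ _ → z≤n
least P? (suc b) p with P? 0
... | yes p₀ = 0 , p₀ , λ _ _ → z≤n
... | no ¬p₀ with least (P? ∘ suc) b p
...   | m , pm , min = suc m , pm , λ
        { zero    p₀ → contradiction p₀ ¬p₀
        ; (suc r) pr → s≤s (min r pr) }

greatest : {P : Pred ℕ 0ℓ} → Decidable P → P 0 →
           ∀ b → (∀ r → P r → r ≤ b) → ∃ (IsGreatest P)
greatest P? p₀ zero    bound = 0 , p₀ , bound
greatest P? p₀ (suc b) bound with P? (suc b)
... | yes p = suc b , p , bound
... | no ¬p = greatest P? p₀ b λ r pr →
        s≤s⁻¹ (≤∧≢⇒< (bound r pr) λ { refl → ¬p pr })

⌈_/_⌉ : (m d : ℕ) .{{_ : NonZero d}} → ℕ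
⌈ m / d ⌉ = (m + pred d) / d

⌈/⌉≤⇔ : ∀ m d c .{{_ : NonZero d}} → ⌈ m / d ⌉ ≤ c ⇔ m ≤ c * d
⌈/⌉≤⇔ m d@(suc e) c = mk⇔ to from
  where
  open ≤-Reasoning
  to : ⌈ m / d ⌉ ≤ c → m ≤ c * d
  to q≤c = +-cancelˡ-≤ e m (c * d) (begin
    e + m                                ≡⟨ +-comm e m ⟩
    m + e                                ≡⟨ m≡m%n+[m/n]*n (m + e) d ⟩
    (m + e) % d + (m + e) / d * d        ≤⟨ +-mono-≤ (s≤s⁻¹ (m%n<n (m + e) d))
                                                     (*-monoˡ-≤ d q≤c) ⟩
    e + c * d                            ∎)
  from : m ≤ c * d → ⌈ m / d ⌉ ≤ c
  from m≤cd = s≤s⁻¹ (m<n*o⇒m/o<n (s≤s (begin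
    m + e      ≤⟨ +-monoˡ-≤ e m≤cd ⟩
    c * d + e  ≡⟨ +-comm (c * d) e ⟩
    e + c * d  ∎)))

Word : ℕ → ℕ → Set
Word k n = Vec (Fin k) n

words : ∀ k n → List (Word k n)
words k zero    = List.[ [] ]
words k (suc n) = cartesianProductWith _∷_ (allFin k) (words k n)

words-complete : ∀ {k n} (w : Word k n) → w ∈ words k n
words-complete []      = here refl
words-complete (a ∷ w) = ∈-cartesianProductWith⁺ _∷_ (∈-allFin a) (words-complete w)

words-unique : ∀ k n → Unique (words k n)
words-unique k zero    = [] ∷ []
words-unique k (suc n) = cartesianProductWith⁺ _∷_ ∷-injective (allFin⁺ k) (words-unique k n)

anyWord? : ∀ {k n} {P : Pred (Word k n) 0ℓ} → Decidable P → Dec (∃ P)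
anyWord? P? = map′
  (λ any → let (w , _ , p) = find any in w , p)
  (λ (w , p) → lose (words-complete w) p)
  (Any.any? P? (words _ _))

HasPeriod : ∀ {k n} → Word k n → ℕ → Set
HasPeriod w q = 1 ≤ q × (∀ i j → toℕ j ≡ toℕ i + q → lookup w i ≡ lookup w j)

hasPeriod? : ∀ {k n} (w : Word k n) → Decidable (HasPeriod w)
hasPeriod? w q = (1 ≤? q) ×-dec
  all? λ i → all? λ j → (toℕ j ≟ toℕ i + q) →-dec (lookup w i Fin.≟ lookup w j)

hasPeriod-length : ∀ {k n} .{{_ : NonZero n}} (w : Word k n) → HasPeriod w n
hasPeriod-length {n = n} w = >-nonZero⁻¹ n , λ i j j≡i+n →
  contradiction (toℕ<n j) (≤⇒≯ (subst (n ≤_) (sym j≡i+n) (m≤n+m n (toℕ i))))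

-- Opaque, so that the instance per-nonZero can recover w from `per w`.
opaque
  leastPeriod : ∀ {k n} .{{_ : NonZero n}} (w : Word k n) → ∃ (IsLeast (HasPeriod w))
  leastPeriod {n = n} w = least (hasPeriod? w) n (hasPeriod-length w)

per : ∀ {k n} .{{_ : NonZero n}} → Word k n → ℕ
per w = proj₁ (leastPeriod w)

instance
  per-nonZero : ∀ {k n} .{{_ : NonZero n}} {w : Word k n} → NonZero (per w)
  per-nonZero {w = w} = >-nonZero (proj₁ (proj₁ (proj₂ (leastPeriod w))))

-- Near the end of w, `take n` returns fewer than n letters, so this forces
-- i + n ≤ L (see occursAt⇒≤).
OccursAt : ∀ {k n L} → Word k n → Word k L → ℕ → Set
OccursAt {n = n} x w i = take n (drop i (toList w)) ≡ toList x

Disjoint : ℕ → ℕ → ℕ → Set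
Disjoint n i j = i < j × n ≤ j ∸ i

HasDisjointRepeat : ∀ {k L} → ℕ → Word k L → Set
HasDisjointRepeat {k} n w =
  ∃[ x ] ∃[ i ] ∃[ j ] OccursAt {k} {n} x w i × OccursAt x w j × Disjoint n i j

AvoidingLength : ℕ → ℕ → ℕ → Set
AvoidingLength k n L = ∃[ w ] ¬ HasDisjointRepeat {k} {L} n w

occursAt⇒≤ : ∀ {k n L} .{{_ : NonZero n}} {x : Word k n} (w : Word k L) {i} →
             OccursAt x w i → i + n ≤ L
occursAt⇒≤ {n = n} {L} {x} w {i} occ = begin
  i + n              ≤⟨ +-monoʳ-≤ i n≤L∸i ⟩
  i + (L ∸ i)        ≡⟨ m+[n∸m]≡n (<⇒≤ (m∸n≢0⇒n<m {L} {i} (λ eq →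
                          <⇒≱ (>-nonZero⁻¹ n) (subst (n ≤_) eq n≤L∸i)))) ⟩
  L                  ∎
  where
  open ≤-Reasoning
  ys = drop i (toList w)
  n≤L∸i : n ≤ L ∸ i
  n≤L∸i = begin
    n                      ≡⟨ length-toList x ⟨
    length (toList x)      ≡⟨ cong length occ ⟨
    length (take n ys)     ≡⟨ length-take n ys ⟩
    n ⊓ length ys          ≤⟨ m⊓n≤n n (length ys) ⟩
    length ys              ≡⟨ length-drop i (toList w) ⟩
    length (toList w) ∸ i  ≡⟨ cong (_∸ i) (length-toList w) ⟩
    L ∸ i                  ∎

occursAt? : ∀ {k n L} (x : Word k n) (w : Word k L) → Decidable (OccursAt x w)
occursAt? x w i = List.≡-dec Fin._≟_ _ _

hasDisjointRepeat? : ∀ {k L} n .{{_ : NonZero n}} → Decidable (HasDisjointRepeat {k} {L} n)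
hasDisjointRepeat? {k} {L} n w = anyWord? λ x → map′
  (λ (i , _ , j , _ , p) → i , j , p)
  (λ (i , j , p@(occᵢ , occⱼ , _)) → i , bound {x} occᵢ , j , bound {x} occⱼ , p)
  (anyUpTo? (λ i → anyUpTo? (λ j →
    occursAt? x w i ×-dec occursAt? x w j ×-dec (i <? j) ×-dec (n ≤? j ∸ i)) L) L)
  where
  bound : ∀ {x : Word k n} {i} → OccursAt x w i → i < L
  bound {x} {i} occ = ≤-trans (m<m+n i (>-nonZero⁻¹ n)) (occursAt⇒≤ {x = x} w occ)

avoidingLength? : ∀ k n .{{_ : NonZero n}} → Decidable (AvoidingLength k n)
avoidingLength? k n L = anyWord? (¬? ∘ hasDisjointRepeat? n)

avoidingLength-0 : ∀ k n .{{_ : NonZero n}} → AvoidingLength k n 0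
avoidingLength-0 k n = [] , λ (x , i , _ , occ , _) →
  contradiction (≤-trans (m≤n+m n i) (occursAt⇒≤ {x = x} [] {i} occ)) (<⇒≱ (>-nonZero⁻¹ n))

factor : ∀ {k n L} (w : Word k L) i → i + n ≤ L → ∃[ x ] OccursAt {k} {n} x w i
factor {k} {n} {L} w i i+n≤L = fromList′ (take n ys) len
  where
  ys = drop i (toList w)
  fromList′ : (zs : List (Fin k)) → length zs ≡ n → ∃[ x ] zs ≡ toList {n = n} x
  fromList′ zs refl = fromList zs , sym (toList∘fromList zs)
  open ≡-Reasoning
  len : length (take n ys) ≡ n
  len = begin
    length (take n ys)           ≡⟨ length-take n ys ⟩
    n ⊓ length ys                ≡⟨ cong (n ⊓_) (length-drop i (toList w)) ⟩
    n ⊓ (length (toList w) ∸ i)  ≡⟨ cong (λ l → n ⊓ (l ∸ i)) (length-toList w) ⟩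
    n ⊓ (L ∸ i)                  ≡⟨ m≤n⇒m⊓n≡m (m+n≤o⇒m≤o∸n n (subst (_≤ L) (+-comm i n) i+n≤L)) ⟩
    n                            ∎

encode-injective : ∀ {k n} {x y : Word k n} →
                   funToFin (lookup x) ≡ funToFin (lookup y) → x ≡ y
encode-injective {x = x} {y} eq = begin
  x                                           ≡⟨ tabulate∘lookup x ⟨
  tabulate (lookup x)                         ≡⟨ tabulate-cong (finToFun-funToFin (lookup x)) ⟨
  tabulate (finToFun (funToFin (lookup x)))   ≡⟨ cong (tabulate ∘ finToFun) eq ⟩
  tabulate (finToFun (funToFin (lookup y)))   ≡⟨ tabulate-cong (finToFun-funToFin (lookup y)) ⟩
  tabulate (lookup y)                         ≡⟨ tabulate∘lookup y ⟩
  y                                           ∎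
  where open ≡-Reasoning

-- Among k ^ n + 1 consecutive blocks of length n, two are equal.
longWord-repeats : ∀ {k n L} .{{_ : NonZero n}} (w : Word k L) →
                   suc (k ^ n) * n ≤ L → HasDisjointRepeat n w
longWord-repeats {k} {n} {L} w long =
  block a , toℕ a * n , toℕ b * n , occ a ,
  subst (λ x → OccursAt x w (toℕ b * n)) (sym (encode-injective eq)) (occ b) ,
  *-monoˡ-< n a<b ,
  m+n≤o⇒m≤o∸n n (*-monoˡ-≤ n a<b)
  where
  fits : (c : Fin (suc (k ^ n))) → toℕ c * n + n ≤ L
  fits c = ≤-trans (≤-reflexive (+-comm (toℕ c * n) n)) (≤-trans (*-monoˡ-≤ n (toℕ<n c)) long)
  block : Fin (suc (k ^ n)) → Word k n
  block c = proj₁ (factor w (toℕ c * n) (fits c))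
  occ : ∀ c → OccursAt (block c) w (toℕ c * n)
  occ c = proj₂ (factor w (toℕ c * n) (fits c))
  collision = pigeonhole (n<1+n (k ^ n)) (funToFin ∘ lookup ∘ block)
  a = proj₁ collision
  b = proj₁ (proj₂ collision)
  a<b = proj₁ (proj₂ (proj₂ collision))
  eq = proj₂ (proj₂ (proj₂ collision))

opaque
  longestAvoiding : ∀ k n .{{_ : NonZero n}} → ∃ (IsGreatest (AvoidingLength k n))
  longestAvoiding k n =
    greatest (avoidingLength? k n) (avoidingLength-0 k n) (suc (k ^ n) * n)
      λ r (w , avoids) → <⇒≤ (≰⇒> (avoids ∘ longWord-repeats w))

C : ∀ k n .{{_ : NonZero n}} → ℕ
C k n = proj₁ (longestAvoiding k n)

{-# OPTIONS --safe #-}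
-- In a word w without disjoint repeats, two occurrences i < j of x satisfy
-- j − i < n, since they overlap, and per x ≤ j − i, since j − i is a period
-- of x.  Hence all occurrences of x lie in a window of n positions at mutual
-- distance at least per x, so there are at most ⌈ n / per x ⌉ of them.  Summing
-- over x counts the |w| + 1 − n positions of w at which a word of length n occurs.
module Submission where

open import Data.Fin using (zero; suc; toℕ)
open import Data.List using (List; []; _∷_; map; length; filter; head; take; drop; upTo)
open import Data.List.Membership.Propositional using (lose)
open import Data.List.Properties using (length-upTo; filter-accept; drop-drop; ∷-injective)
open import Data.List.Relation.Unary.All as All using (All; []; _∷_)
open import Data.List.Relation.Unary.All.Properties using (all-upTo; all-filter)
open import Data.List.Relation.Unary.AllPairs using (AllPairs; []; _∷_)
open import Data.List.Relation.Unary.AllPairs.Properties using (filter⁺; applyUpTo⁺₁)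
open import Data.List.Relation.Unary.Any as Any using (Any; here; there)
open import Data.Maybe using (just)
open import Data.Maybe.Properties using (just-injective)
open import Data.Nat using (ℕ; suc; NonZero; _+_; _∸_; _*_; _≤_; _<_; z≤n; s≤s⁻¹; >-nonZero⁻¹)
open import Data.Nat.ListAction using (sum)
open import Data.Nat.Properties
open import Data.Product using (_×_; _,_; proj₁; proj₂)
open import Data.Vec using (Vec; _∷_; lookup; toList)
open import Function using (id; Equivalence)
open import Level using (Level)
open import Relation.Binary using (Rel)
open import Relation.Binary.PropositionalEquality
open import Relation.Nullary using (¬_; yes; no)
open import Relation.Unary using (Pred; Decidable)
open import Defs

private
  variable
    a b ℓ ℓ₁ ℓ₂ : Level
    A : Set a
    B : Set b

sum-map-mono-≤ : {f g : A → ℕ} → (∀ x → f x ≤ g x) → ∀ xs → sum (map f xs) ≤ sum (map g xs)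
sum-map-mono-≤ f≤g []       = z≤n
sum-map-mono-≤ f≤g (x ∷ xs) = +-mono-≤ (f≤g x) (sum-map-mono-≤ f≤g xs)

sum-map-mono-< : {f g : A → ℕ} → (∀ x → f x ≤ g x) →
                 ∀ {xs} → Any (λ x → f x < g x) xs → sum (map f xs) < sum (map g xs)
sum-map-mono-< f≤g {_ ∷ xs} (here fx<gx) = +-mono-<-≤ fx<gx (sum-map-mono-≤ f≤g xs)
sum-map-mono-< f≤g {x ∷ _}  (there any)  = +-mono-≤-< (f≤g x) (sum-map-mono-< f≤g any)

length-filter-∷ : {P : Pred A ℓ} (P? : Decidable P) → ∀ x xs →
                  length (filter P? xs) ≤ length (filter P? (x ∷ xs))
length-filter-∷ P? x xs with P? x
... | yes _ = n≤1+n _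
... | no  _ = ≤-refl

-- Double counting, by induction on `ys`: prepending `y` shrinks no summand and strictly enlarges
-- one, since some entry of `xs` is related to `y`.
length≤sum-filter : {_~_ : A → B → Set ℓ} (_~?_ : ∀ x → Decidable (x ~_)) (xs : List A) →
                    ∀ {ys} → All (λ y → Any (_~ y) xs) ys →
                    length ys ≤ sum (map (λ x → length (filter (x ~?_) ys)) xs)
length≤sum-filter _~?_ xs []                        = z≤n
length≤sum-filter _~?_ xs {y ∷ ys} (covered ∷ rest) = ≤-<-trans
  (length≤sum-filter _~?_ xs rest)
  (sum-map-mono-< (λ x → length-filter-∷ (x ~?_) y ys)
    (Any.map
      (λ {x} x~y → ≤-reflexive (cong length (sym (filter-accept (x ~?_) x~y)))) covered))

allPairs-refine : {P : Pred A ℓ} {R : Rel A ℓ₁} {S : Rel A ℓ₂} →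
                  (∀ {x y} → P x → P y → R x y → S x y) →
                  ∀ {xs} → All P xs → AllPairs R xs → AllPairs S xs
allPairs-refine f []       []       = []
allPairs-refine f (p ∷ ps) (r ∷ rs) =
  All.zipWith (λ (q , xRy) → f p q xRy) (ps , r) ∷ allPairs-refine f ps rs

-- The gaps telescope: `length is` steps of at least `d` lead from `i` to the last entry, which is
-- still below `m`.
separated-span : ∀ {d m i is} → AllPairs (λ i j → i + d ≤ j × j < m) (i ∷ is) → i < m →
                 i + length is * d < m
separated-span {d} {m} {i} {[]} _ i<m = subst (_< m) (sym (+-identityʳ i)) i<m
separated-span {d} {m} {i} {j ∷ js} (((i+d≤j , j<m) ∷ _) ∷ rest) _ = begin-strict
  i + (d + length js * d)  ≡⟨ +-assoc i d _ ⟨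
  i + d + length js * d    ≤⟨ +-monoˡ-≤ _ i+d≤j ⟩
  j + length js * d        <⟨ separated-span rest j<m ⟩
  m                        ∎
  where open ≤-Reasoning

separated-length : ∀ {n d is} .{{_ : NonZero n}} .{{_ : NonZero d}} →
                   AllPairs (λ i j → i + d ≤ j × j < i + n) is → length is ≤ ⌈ n / d ⌉
separated-length {is = []} _ = z≤n
-- Here `is` is the tail, so the goal is `length is < ⌈ n / d ⌉`. Otherwise `n ≤ length is * d`, and
-- the span would leave the window of length `n` that starts at `i`.
separated-length {n} {d} {i ∷ is} pairs@(fromHead ∷ rest) = ≰⇒> λ ⌈n/d⌉≤ →
  <⇒≱ (+-cancelˡ-< i _ _ (separated-span inWindow (m<m+n i (>-nonZero⁻¹ n))))
      (Equivalence.to (⌈/⌉≤⇔ n d (length is)) ⌈n/d⌉≤)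
  where
  inWindow : AllPairs (λ j k → j + d ≤ k × k < i + n) (i ∷ is)
  -- The upper bound relative to each left entry is replaced by the one relative to the first entry.
  inWindow = fromHead ∷ allPairs-refine
    (λ _ k<i+n (j+d≤k , _) → j+d≤k , k<i+n) (All.map proj₂ fromHead) rest

-- Reading a letter as `head (drop _ _)` is total, so equal positions in `w` can be rewritten by
-- arithmetic in ℕ without carrying bounds.
head-drop-prefix : ∀ {n} (x : Vec A n) zs → take n zs ≡ toList x →
                   ∀ a → head (drop (toℕ a) zs) ≡ just (lookup x a)
head-drop-prefix (_ ∷ _) (_ ∷ _)  eq zero    = cong just (proj₁ (∷-injective eq))
head-drop-prefix (_ ∷ x) (_ ∷ zs) eq (suc a) = head-drop-prefix x zs (proj₂ (∷-injective eq)) a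

module _ {k L} (w : Word k L) where

  occursAt-lookup : ∀ {n} (x : Word k n) i → OccursAt x w i →
                    ∀ a → head (drop (i + toℕ a) (toList w)) ≡ just (lookup x a)
  occursAt-lookup x i occ a = trans
    (cong head (sym (drop-drop i (toℕ a) (toList w))))
    (head-drop-prefix x (drop i (toList w)) occ a)

  -- If `b = a + (j ∸ i)`, then letter `b` of the occurrence at `i` and letter `a` of the occurrence
  -- at `j` are the same letter of `w`.
  occursAt-hasPeriod : ∀ {n} (x : Word k n) {i j} → OccursAt x w i → OccursAt x w j →
                       i < j → HasPeriod x (j ∸ i)
  occursAt-hasPeriod x {i} {j} occᵢ occⱼ i<j = m<n⇒0<n∸m i<j , λ a b b≡a+q →
    just-injective (begin
      just (lookup x a)                      ≡⟨ occursAt-lookup x j occⱼ a ⟨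
      head (drop (j + toℕ a) (toList w))     ≡⟨ cong (λ m → head (drop m (toList w))) (shift a b b≡a+q) ⟩
      head (drop (i + toℕ b) (toList w))     ≡⟨ occursAt-lookup x i occᵢ b ⟩
      just (lookup x b)                      ∎)
    where
    open ≡-Reasoning
    shift : ∀ a b → toℕ b ≡ toℕ a + (j ∸ i) → j + toℕ a ≡ i + toℕ b
    shift a b b≡a+q = begin
      j + toℕ a                ≡⟨ cong (_+ toℕ a) (m+[n∸m]≡n (<⇒≤ i<j)) ⟨
      i + (j ∸ i) + toℕ a      ≡⟨ +-assoc i (j ∸ i) (toℕ a) ⟩
      i + (j ∸ i + toℕ a)      ≡⟨ cong (i +_) (+-comm (j ∸ i) (toℕ a)) ⟩
      i + (toℕ a + (j ∸ i))    ≡⟨ cong (i +_) b≡a+q ⟨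
      i + toℕ b                ∎

  module _ {n} .{{_ : NonZero n}} (avoids : ¬ HasDisjointRepeat {k} {L} n w) where

    occurrences-separated : ∀ (x : Word k n) {i j} → OccursAt x w i → OccursAt x w j → i < j →
                            i + per x ≤ j × j < i + n
    occurrences-separated x {i} {j} occᵢ occⱼ i<j =
      subst (i + per x ≤_) i+q≡j
        (+-monoʳ-≤ i (proj₂ (proj₂ (leastPeriod x)) (j ∸ i) (occursAt-hasPeriod x occᵢ occⱼ i<j))) ,
      subst (_< i + n) i+q≡j
        (+-monoʳ-< i (≰⇒> λ n≤q → avoids (x , i , j , occᵢ , occⱼ , i<j , n≤q)))
      where
      i+q≡j : i + (j ∸ i) ≡ j
      i+q≡j = m+[n∸m]≡n (<⇒≤ i<j)

    occurrences-length : ∀ (x : Word k n) m →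
                         length (filter (occursAt? x w) (upTo m)) ≤ ⌈ n / per x ⌉
    occurrences-length x m = separated-length (allPairs-refine
      (occurrences-separated x)
      (all-filter (occursAt? x w) (upTo m))
      (filter⁺ (occursAt? x w) (applyUpTo⁺₁ id m λ i<j _ → i<j)))

    avoiding-length : suc L ≤ n + sum (map (λ x → ⌈ n / per x ⌉) (words k n))
    -- `m` counts the positions `i` with `i + n ≤ L`. If `L < n`, truncation makes it 0 and this
    -- first inequality still holds.
    avoiding-length = ≤-trans (m≤n+m∸n (suc L) n) (+-monoʳ-≤ n (begin
      m                                                                         ≡⟨ length-upTo m ⟨
      length (upTo m)                                                           ≤⟨ length≤sum-filter (λ x → occursAt? x w) (words k n) covered ⟩
      sum (map (λ x → length (filter (occursAt? x w) (upTo m))) (words k n))    ≤⟨ sum-map-mono-≤ (λ x → occurrences-length x m) (words k n) ⟩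
      sum (map (λ x → ⌈ n / per x ⌉) (words k n))                               ∎))
      where
      open ≤-Reasoning
      m : ℕ
      m = suc L ∸ n
      fits : ∀ {i} → i < m → i + n ≤ L
      -- From `i < m`, `m` is nonzero, so the subtraction defining it was not truncated and can be
      -- undone.
      fits i<m = s≤s⁻¹ (m≤o∸n⇒m+n≤o _ (<⇒≤ (m∸n≢0⇒n<m (m<n⇒n≢0 i<m))) i<m)
      covered : All (λ i → Any (λ x → OccursAt x w i) (words k n)) (upTo m)
      covered = All.map
        (λ i<m → let (x , occ) = factor w _ (fits i<m) in lose (words-complete x) occ)
        (all-upTo m)

theorem6 : (k n : ℕ) .{{_ : NonZero k}} .{{_ : NonZero n}} →
    C k n ≤ (sum (map (λ w → ⌈ n / per w ⌉) (words k n)) + n) ∸ 1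
theorem6 k n with longestAvoiding k n
-- `L` is `C k n` and `w` is a word attaining it; the strict bound on `L` accounts for the final
-- `∸ 1`.
... | L , (w , avoids) , _ =
  <⇒≤pred (subst (L <_) (+-comm n _) (avoiding-length w avoids))
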